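{- For every nonnegative integer $n$, $$p(n)=\sum_{j=0}^{\infty}pod(j)\,P_2'(n-j).$$
   Context: $p(n)$ denotes the number of (unrestricted) partitions of $n$, with $p(0)=1$. $pod(n)$ denotes the number of partitions of $n$ in which odd parts are distinct and even parts may be repeated, with $pod(0)=1$. $P_2'(n)$ denotes the number of partitions of $n$ into parts congruent to $2\pmod 4$, with $P_2'(0)=1$ and $P_2'(m)=0$ for $m<0$. -}

module Defs where

open import Data.Integer.Base using (ℤ; +_; -[1+_])
open import Data.List.Base using (List; []; _∷_; cartesianProductWith; filter; length; map; upTo)
open import Data.List.Membership.Propositional using (_∈_)
open import Data.List.Membership.Propositional.Properties
  using (∈-cartesianProductWith⁺; ∈-cartesianProductWith⁻; ∈-filter⁺; ∈-filter⁻; ∈-map⁺; ∈-upTo⁺)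
open import Data.List.Properties using (∷-injective)
open import Data.List.Relation.Unary.All as All using (All; []; _∷_)
open import Data.List.Relation.Unary.AllPairs using ([]; _∷_)
open import Data.List.Relation.Unary.Any using (here; there)
open import Data.List.Relation.Unary.Linked using (Linked; linked?)
open import Data.List.Relation.Unary.Unique.DecPropositional using (unique?)
open import Data.List.Relation.Unary.Unique.Propositional using (Unique)
import Data.List.Relation.Unary.Unique.Propositional.Properties as Unique
open import Data.Nat.Base using (ℕ; zero; suc; _≤_; _<_; _≥_; z≤n; s≤s)
open import Data.Nat.Divisibility using (_∣_; _∣?_)
open import Data.Nat.DivMod using (_%_)
open import Data.Nat.ListAction using (sum)
open import Data.Nat.Properties
  using (_≟_; _<?_; _≥?_; suc-injective; ≤-trans; m≤m+n; m≤n+m; +-mono-≤)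
open import Data.Product.Base using (∃-syntax; _×_; _,_; proj₂)
open import Relation.Binary.PropositionalEquality using (_≡_; refl)
open import Relation.Nullary using (¬_)
open import Relation.Nullary.Decidable using (_×-dec_; ¬?)
open import Relation.Unary using (Decidable)

-- A partition is represented by the list of its parts in weakly
-- decreasing order.
IsPartition : ℕ → List ℕ → Set
IsPartition n xs = All (0 <_) xs × Linked _≥_ xs × sum xs ≡ n

isPartition? : ∀ n → Decidable (IsPartition n)
isPartition? n xs = All.all? (0 <?_) xs ×-dec (linked? _≥?_ xs ×-dec (sum xs ≟ n))

-- All lists of length at most k with entries in {1, …, n}.
boundedLists : ℕ → ℕ → List (List ℕ)
boundedLists n zero    = [] ∷ []
boundedLists n (suc k) =
  [] ∷ cartesianProductWith _∷_ (map suc (upTo n)) (boundedLists n k)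

-- A partition of n has at most n parts, each at most n, so none is missed;
-- see ∈-partitions⁺, ∈-partitions⁻ and partitions-unique.
partitions : ℕ → List (List ℕ)
partitions n = filter (isPartition? n) (boundedLists n n)

Odd : ℕ → Set
Odd x = ¬ (2 ∣ x)

odd? : Decidable Odd
odd? x = ¬? (2 ∣? x)

OddPartsDistinct : List ℕ → Set
OddPartsDistinct xs = Unique (filter odd? xs)

oddPartsDistinct? : Decidable OddPartsDistinct
oddPartsDistinct? xs = unique? _≟_ (filter odd? xs)

AllParts≡2mod4 : List ℕ → Set
AllParts≡2mod4 = All (λ x → x % 4 ≡ 2)

allParts≡2mod4? : Decidable AllParts≡2mod4
allParts≡2mod4? = All.all? (λ x → x % 4 ≟ 2)

p : ℕ → ℕ
p n = length (partitions n)

pod : ℕ → ℕ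
pod n = length (filter oddPartsDistinct? (partitions n))

P₂′ : ℤ → ℕ
P₂′ (+ n)    = length (filter allParts≡2mod4? (partitions n))
P₂′ -[1+ _ ] = 0

-- The infinite series f 0 + f 1 + f 2 + ⋯ of natural numbers has sum s:
-- convergence in the discrete space ℕ means that the partial sums are
-- eventually constant.
infix 4 _HasSum_

_HasSum_ : (ℕ → ℕ) → ℕ → Set
f HasSum s = ∃[ N ] (∀ m → N ≤ m → sum (map f (upTo m)) ≡ s)

∈-boundedLists⁺ : ∀ {n k xs} → All (0 <_) xs → All (_≤ n) xs → length xs ≤ k →
                  xs ∈ boundedLists n k
∈-boundedLists⁺ {k = zero}  []            []          _         = here refl
∈-boundedLists⁺ {k = suc k} []            []          _         = here refl
∈-boundedLists⁺ {k = suc k} (s≤s _ ∷ pos) (x≤n ∷ bnd) (s≤s len) =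
  there (∈-cartesianProductWith⁺ _∷_ (∈-map⁺ suc (∈-upTo⁺ x≤n))
                                     (∈-boundedLists⁺ pos bnd len))

parts≤sum : ∀ xs → All (_≤ sum xs) xs
parts≤sum []       = []
parts≤sum (x ∷ xs) =
  m≤m+n x (sum xs) ∷ All.map (λ y≤ → ≤-trans y≤ (m≤n+m (sum xs) x)) (parts≤sum xs)

length≤sum : ∀ {xs} → All (0 <_) xs → length xs ≤ sum xs
length≤sum []          = z≤n
length≤sum (0<x ∷ pos) = +-mono-≤ 0<x (length≤sum pos)

∈-partitions⁺ : ∀ {n xs} → IsPartition n xs → xs ∈ partitions n
∈-partitions⁺ {xs = xs} q@(pos , _ , refl) =
  ∈-filter⁺ (isPartition? _) (∈-boundedLists⁺ pos (parts≤sum xs) (length≤sum pos)) q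

∈-partitions⁻ : ∀ {n xs} → xs ∈ partitions n → IsPartition n xs
∈-partitions⁻ {n} xs∈ = proj₂ (∈-filter⁻ (isPartition? n) {xs = boundedLists n n} xs∈)

boundedLists-unique : ∀ n k → Unique (boundedLists n k)
boundedLists-unique n zero    = [] ∷ []
boundedLists-unique n (suc k) =
  All.tabulate (λ { v∈ refl → []∉ v∈ }) ∷
  Unique.cartesianProductWith⁺ _∷_ ∷-injective
    (Unique.map⁺ suc-injective (Unique.upTo⁺ n)) (boundedLists-unique n k)
  where
  []∉ : ¬ ([] ∈ cartesianProductWith _∷_ (map suc (upTo n)) (boundedLists n k))
  []∉ v∈ with ∈-cartesianProductWith⁻ _∷_ (map suc (upTo n)) (boundedLists n k) v∈
  ... | _ , _ , _ , _ , ()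

partitions-unique : ∀ n → Unique (partitions n)
partitions-unique n = Unique.filter⁺ (isPartition? n) (boundedLists-unique n n)

{-# OPTIONS --safe #-}

-- Pair up equal odd parts of a partition of n: an odd part x occurring 2q + r
-- times with r ≤ 1 contributes r copies of x to a partition μ with distinct odd
-- parts and q copies of 2x ≡ 2 (mod 4) to a partition ν; all even parts go to μ.
-- This is a bijection onto the pairs (μ , ν) of total size n that the sum counts.
module Submission where

open import Defs
open import Data.Nat.Base using (ℕ; _*_)
open import Data.Integer.Base using (+_; _-_)

open import Data.Integer.Base using (ℤ; -[1+_])
import Data.Integer.Base as ℤ
import Data.Integer.Properties as ℤ
import Algebra.Properties.AbelianGroup ℤ.+-0-abelianGroup as ℤ-Group
open import Data.List.Base
  using (List; []; _∷_; _++_; cartesianProduct; concat; filter; foldr; length; map; upTo)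
open import Data.List.Membership.Propositional using (_∈_)
open import Data.List.Membership.Propositional.Properties
  using (∈-cartesianProduct⁺; ∈-cartesianProduct⁻; ∈-concat⁺′; ∈-concat⁻′; ∈-filter⁺; ∈-filter⁻;
         ∈-map⁺; ∈-map⁻; ∈-upTo⁺)
open import Data.List.Membership.Propositional.Properties.WithK using (unique∧set⇒bag)
open import Data.List.Properties
  using (filter-accept; filter-reject; length-++; length-map; map-cong; map-injective)
open import Data.List.Relation.Binary.BagAndSetEquality using (∼bag⇒↭)
open import Data.List.Relation.Binary.Disjoint.Propositional using (Disjoint)
open import Data.List.Relation.Binary.Equality.Propositional using (≋⇒≡)
open import Data.List.Relation.Binary.Permutation.Propositional
  using (_↭_; prep; ↭-refl; ↭-sym; ↭-trans; ↭⇒↭ₛ; module PermutationReasoning)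
open import Data.List.Relation.Binary.Permutation.Propositional.Properties
  using (All-resp-↭; shift; ++⁺ˡ; ↭-length)
open import Data.List.Relation.Unary.All as All using (All; []; _∷_)
import Data.List.Relation.Unary.All.Properties as All
open import Data.List.Relation.Unary.AllPairs as AllPairs using (AllPairs; []; _∷_)
import Data.List.Relation.Unary.AllPairs.Properties as AllPairs
open import Data.List.Relation.Unary.Any using (here; there)
open import Data.List.Relation.Unary.Linked using (Linked)
open import Data.List.Relation.Unary.Linked.Properties using (Linked⇒AllPairs; AllPairs⇒Linked)
open import Data.List.Relation.Unary.Sorted.TotalOrder.Properties using (↗↭↗⇒≋)
open import Data.List.Relation.Unary.Unique.Propositional using (Unique)
import Data.List.Relation.Unary.Unique.Propositional.Properties as Unique
import Data.Nat.Base as ℕ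
open import Data.Nat.Base using (suc; _+_; _/_; _≤_; _<_; _≥_; _>_; z≤n; s≤s; ⌊_/2⌋)
open import Data.Nat.Divisibility using (_∣_; divides-refl; ∣m+n∣m⇒∣n; m%n≡0⇒n∣m; ∣1⇒≡1)
open import Data.Nat.DivMod using (_%_; m≡m%n+[m/n]*n; [m+kn]%n≡m%n; m%n<n)
open import Data.Nat.ListAction using (sum)
open import Data.Nat.ListAction.Properties using (sum-++; sum-↭)
open import Data.Nat.Properties
open import Data.Nat.Tactic.RingSolver using (solve-∀)
open import Data.Product.Base using (∃-syntax; _×_; _,_; proj₁; proj₂)
open import Data.Product.Properties using (,-injective)
open import Data.Sum.Base using ([_,_]′)
open import Function.Base using (_∘_; flip)
open import Function.Bundles using (mk⇔)
open import Relation.Binary.Properties.TotalOrder ≤-totalOrder using (≥-totalOrder)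
open import Relation.Binary.PropositionalEquality
open import Relation.Nullary using (yes; no; contradiction)
open import Relation.Nullary.Decidable using (_×-dec_)

private
  variable
    A B : Set
    x y : ℕ
    xs ys μ κ ν : List ℕ

-- Lengths, uniqueness and sorting of lists

length-concat-map : (f : A → List B) (xs : List A) →
                    length (concat (map f xs)) ≡ sum (map (length ∘ f) xs)
length-concat-map f []       = refl
length-concat-map f (x ∷ xs) =
  trans (length-++ (f x)) (cong (length (f x) ℕ.+_) (length-concat-map f xs))

length-cartesianProduct : (xs : List A) (ys : List B) →
                          length (cartesianProduct xs ys) ≡ length xs * length ys
length-cartesianProduct []       ys = refl
length-cartesianProduct (x ∷ xs) ys =
  trans (length-++ (map (x ,_) ys))
        (cong₂ _+_ (length-map (x ,_) ys) (length-cartesianProduct xs ys))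

-- Injectivity is asked on the entries only because `toPair` is injective on decreasing lists but
-- not on all lists: it sends `1 ∷ 1 ∷ 2 ∷ []` and `2 ∷ 1 ∷ 1 ∷ []` to the same pair.
map⁺-injectiveOn : {f : A → B} {xs : List A} →
                   (∀ {x y} → x ∈ xs → y ∈ xs → f x ≡ f y → x ≡ y) →
                   Unique xs → Unique (map f xs)
map⁺-injectiveOn inj []         = []
map⁺-injectiveOn inj (x∉ ∷ xs!) =
  All.map⁺ (All.tabulate λ y∈ eq → All.lookup x∉ y∈ (inj (here refl) (there y∈) eq)) ∷
  map⁺-injectiveOn (λ y∈ z∈ → inj (there y∈) (there z∈)) xs!

AllPairs-≥-↭⇒≡ : AllPairs _≥_ xs → AllPairs _≥_ ys → xs ↭ ys → xs ≡ ys
AllPairs-≥-↭⇒≡ xs↘ ys↘ xs↭ys =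
  ≋⇒≡ (↗↭↗⇒≋ ≥-totalOrder (AllPairs⇒Linked xs↘) (AllPairs⇒Linked ys↘) (↭⇒↭ₛ xs↭ys))

Linked⇒AllPairs-≥ : Linked _≥_ xs → AllPairs _≥_ xs
Linked⇒AllPairs-≥ = Linked⇒AllPairs (flip ≤-trans)

-- Decreasing lists with distinct odd parts

infix 4 _≥ᵒ_

-- Merges weak decrease and distinctness of odd parts into one pairwise relation, so that both are
-- carried together in inductions on the list.
_≥ᵒ_ : ℕ → ℕ → Set
x ≥ᵒ y = x ≥ y × (Odd x → x ≢ y)

>⇒≥ᵒ : x > y → x ≥ᵒ y
>⇒≥ᵒ x>y = <⇒≤ x>y , λ _ → >⇒≢ x>y

≥∧distinct⇒≥ᵒ : AllPairs _≥_ xs → OddPartsDistinct xs → AllPairs _≥ᵒ_ xs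
≥∧distinct⇒≥ᵒ []                        _ = []
≥∧distinct⇒≥ᵒ {x ∷ xs} (x≥ ∷ xs↘) d with odd? x
... | yes ox with x∉ ∷ d′ ← subst Unique (filter-accept odd? ox) d =
  All.tabulate (λ y∈ → All.lookup x≥ y∈ ,
    λ _ x≡y → All.lookup x∉ (∈-filter⁺ odd? y∈ (subst Odd x≡y ox)) x≡y) ∷
  ≥∧distinct⇒≥ᵒ xs↘ d′
... | no ¬ox = All.map (λ x≥y → x≥y , λ ox → contradiction ox ¬ox) x≥ ∷
  ≥∧distinct⇒≥ᵒ xs↘ (subst Unique (filter-reject odd? ¬ox) d)

≥ᵒ⇒distinct : AllPairs _≥ᵒ_ xs → OddPartsDistinct xs
≥ᵒ⇒distinct []                         = []
≥ᵒ⇒distinct {x ∷ xs} (x≥ᵒ ∷ xs↘) with odd? x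
... | yes ox = subst Unique (sym (filter-accept odd? ox))
                 (All.filter⁺ odd? (All.map (λ x≥ᵒy → proj₂ x≥ᵒy ox) x≥ᵒ) ∷ ≥ᵒ⇒distinct xs↘)
... | no ¬ox = subst Unique (sym (filter-reject odd? ¬ox)) (≥ᵒ⇒distinct xs↘)

-- Splitting off pairs of equal odd parts

-- In a decreasing list only the head of the first component can equal the
-- part being inserted.
insert : ℕ → List ℕ × List ℕ → List ℕ × List ℕ
insert x ([]    , κ) = x ∷ [] , κ
insert x (y ∷ μ , κ) with odd? x ×-dec x ≟ y
... | yes _ = μ , x ∷ κ
... | no  _ = x ∷ y ∷ μ , κ

-- The second component records x, not 2x, for each pair of equal odd parts x.
split : List ℕ → List ℕ × List ℕ
split = foldr insert ([] , [])

insert-fresh : All (x ≥ᵒ_) μ → insert x (μ , κ) ≡ (x ∷ μ , κ)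
insert-fresh         []              = refl
insert-fresh {x} {y ∷ _} ((_ , x≢y) ∷ _) with odd? x ×-dec x ≟ y
... | yes (ox , x≡y) = contradiction x≡y (x≢y ox)
... | no _           = refl

insert-twin : Odd x → insert x (x ∷ μ , κ) ≡ (μ , x ∷ κ)
insert-twin {x} ox with odd? x ×-dec x ≟ x
... | yes _ = refl
... | no ¬p = contradiction (ox , refl) ¬p

unpair : List ℕ × List ℕ → List ℕ
unpair (μ , κ) = μ ++ κ ++ κ

insert-↭ : ∀ x μκ → unpair (insert x μκ) ↭ x ∷ unpair μκ
insert-↭ x ([]    , κ) = ↭-refl
insert-↭ x (y ∷ μ , κ) with odd? x ×-dec x ≟ y
... | yes (_ , refl) = begin
  μ ++ x ∷ κ ++ x ∷ κ    ↭⟨ shift x μ (κ ++ x ∷ κ) ⟩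
  x ∷ μ ++ κ ++ x ∷ κ    ↭⟨ prep x (++⁺ˡ μ (shift x κ κ)) ⟩
  x ∷ μ ++ x ∷ κ ++ κ    ↭⟨ prep x (shift x μ (κ ++ κ)) ⟩
  x ∷ x ∷ μ ++ κ ++ κ    ∎
  where open PermutationReasoning
... | no _ = ↭-refl

-- All order-independent facts about `split` come from here: bounds on the parts, preservation of
-- the sum, and injectivity.
split-↭ : ∀ xs → unpair (split xs) ↭ xs
split-↭ []       = ↭-refl
split-↭ (x ∷ xs) = ↭-trans (insert-↭ x (split xs)) (prep x (split-↭ xs))

split-All : ∀ {P : ℕ → Set} xs → All P xs → All P (proj₁ (split xs)) × All P (proj₂ (split xs))
split-All xs pxs with pμ , pκκ ← All.++⁻ (proj₁ (split xs)) (All-resp-↭ (↭-sym (split-↭ xs)) pxs) =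
  pμ , All.++⁻ˡ _ pκκ

-- Describes the image of `split` on decreasing lists: `split-splitForm` and `split-surjective` give
-- the two inclusions.
SplitForm : List ℕ × List ℕ → Set
SplitForm (μ , κ) = AllPairs _≥ᵒ_ μ × AllPairs _≥_ κ × All Odd κ

insert-splitForm : All (x ≥_) μ → All (x ≥_) κ → SplitForm (μ , κ) → SplitForm (insert x (μ , κ))
insert-splitForm {μ = []}        _           _   (_ , κ↘ , oκ) = [] ∷ [] , κ↘ , oκ
insert-splitForm {x} {μ = y ∷ μ} (x≥y ∷ x≥μ) x≥κ (y≥ᵒ ∷ μ↘ , κ↘ , oκ) with odd? x ×-dec x ≟ y
... | yes (ox , _) = μ↘ , x≥κ ∷ κ↘ , ox ∷ oκ
... | no ¬twin     =
  ((x≥y , λ ox x≡y → ¬twin (ox , x≡y)) ∷ All.zipWith fresh (x≥μ , y≥ᵒ)) ∷ y≥ᵒ ∷ μ↘ , κ↘ , oκ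
  where
  fresh : ∀ {z} → x ≥ z × y ≥ᵒ z → x ≥ᵒ z
  -- If an odd `x` equalled `z`, then `x ≥ y ≥ z` would force `x ≡ y`, the twin case already
  -- excluded.
  fresh (x≥z , y≥z , _) = x≥z , λ { ox refl → ¬twin (ox , ≤-antisym y≥z x≥y) }

split-splitForm : AllPairs _≥_ xs → SplitForm (split xs)
split-splitForm             []         = [] , [] , []
split-splitForm {xs = _ ∷ xs} (x≥ ∷ xs↘) with x≥μ , x≥κ ← split-All xs x≥ =
  insert-splitForm x≥μ x≥κ (split-splitForm xs↘)

-- The pair `split xs` determines the multiset of parts through `unpair`, and a decreasing list is
-- determined by its multiset.
split-injective : AllPairs _≥_ xs → AllPairs _≥_ ys → split xs ≡ split ys → xs ≡ ys
split-injective {xs} {ys} xs↘ ys↘ eq = AllPairs-≥-↭⇒≡ xs↘ ys↘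
  (↭-trans (↭-sym (split-↭ xs)) (subst (λ μκ → unpair μκ ↭ ys) (sym eq) (split-↭ ys)))

-- Surjectivity of the splitting

SplitFibre : List ℕ → List ℕ → Set
SplitFibre μ κ = ∃[ xs ] AllPairs _≥_ xs × split xs ≡ (μ , κ)

fibre-All : ∀ {P : ℕ → Set} → All P μ → All P κ → split xs ≡ (μ , κ) → All P xs
fibre-All {xs = xs} pμ pκ eq =
  All-resp-↭ (subst (λ μκ → unpair μκ ↭ xs) eq (split-↭ xs)) (All.++⁺ pμ (All.++⁺ pκ pκ))

fibre-fresh : All (x ≥ᵒ_) μ → All (x ≥_) κ → SplitFibre μ κ → SplitFibre (x ∷ μ) κ
fibre-fresh {x} x≥ᵒμ x≥κ (xs , xs↘ , eq) =
  x ∷ xs , fibre-All (All.map proj₁ x≥ᵒμ) x≥κ eq ∷ xs↘ ,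
  trans (cong (insert x) eq) (insert-fresh x≥ᵒμ)

-- Two copies of `x` go in front of the preimage. As `x` exceeds all of `μ`, the first becomes the
-- head of the first component; the second then meets it there and moves the pair to `κ`.
fibre-twins : Odd x → All (x >_) μ → All (x ≥_) κ → SplitFibre μ κ → SplitFibre μ (x ∷ κ)
fibre-twins {x} ox x>μ x≥κ fib with xs , x∷xs↘ , eq ← fibre-fresh (All.map >⇒≥ᵒ x>μ) x≥κ fib =
  x ∷ xs , fibre-All (≤-refl ∷ All.map <⇒≤ x>μ) x≥κ eq ∷ x∷xs↘ ,
  trans (cong (insert x) eq) (insert-twin ox)

-- The preimage is built from its largest part, which heads `μ` or `κ`. A tie must go to `μ`: the
-- odd head of `μ` is then removed first, leaving only smaller parts, as `fibre-twins` requires.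
split-surjective : ∀ μ κ → SplitForm (μ , κ) → SplitFibre μ κ
split-surjective [] [] _ = [] , [] , refl
split-surjective (x ∷ μ) [] (x≥ᵒ ∷ μ↘ , [] , []) =
  fibre-fresh x≥ᵒ [] (split-surjective μ [] (μ↘ , [] , []))
split-surjective [] (h ∷ κ) ([] , h≥ ∷ κ↘ , oh ∷ oκ) =
  fibre-twins oh [] h≥ (split-surjective [] κ ([] , κ↘ , oκ))
split-surjective (x ∷ μ) (h ∷ κ) (x≥ᵒ ∷ μ↘ , h≥ ∷ κ↘ , oh ∷ oκ) =
  [ (λ h≤x → fibre-fresh x≥ᵒ (h≤x ∷ All.map (λ y≤h → ≤-trans y≤h h≤x) h≥)
      (split-surjective μ (h ∷ κ) (μ↘ , h≥ ∷ κ↘ , oh ∷ oκ)))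
  , (λ x<h → fibre-twins oh (x<h ∷ All.map (λ x≥ᵒy → ≤-<-trans (proj₁ x≥ᵒy) x<h) x≥ᵒ) h≥
      (split-surjective (x ∷ μ) κ (x≥ᵒ ∷ μ↘ , κ↘ , oκ)))
  ]′ (≤-<-connex h x)

-- Doubles of odd numbers and the residue 2 modulo 4

double : ℕ → ℕ
double x = x + x

double-injective : double x ≡ double y → x ≡ y
double-injective {x} {y} eq =
  trans (n≡⌊n+n/2⌋ x) (trans (cong ⌊_/2⌋ eq) (sym (n≡⌊n+n/2⌋ y)))

sum-map-double : ∀ κ → sum (map double κ) ≡ sum κ + sum κ
sum-map-double []      = refl
sum-map-double (x ∷ κ) = trans (cong (x + x ℕ.+_) (sum-map-double κ)) (lemma x (sum κ))
  where
  lemma : ∀ a b → a + a + (b + b) ≡ a + b + (a + b)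
  lemma = solve-∀

odd⇒%2≡1 : Odd x → x % 2 ≡ 1
odd⇒%2≡1 {x} ox with x % 2 in eq | m%n<n x 2
... | 0           | _             = contradiction (m%n≡0⇒n∣m x 2 eq) ox
... | 1           | _             = refl
... | suc (suc _) | s≤s (s≤s ())

double-1+2q : ∀ q → (1 + q * 2) + (1 + q * 2) ≡ 2 + q * 4
double-1+2q = solve-∀

double-odd : Odd x → double x % 4 ≡ 2
double-odd {x} ox = begin
  double x % 4                ≡⟨ cong (λ z → double z % 4) (m≡m%n+[m/n]*n x 2) ⟩
  double (x % 2 + q * 2) % 4  ≡⟨ cong (λ r → double (r + q * 2) % 4) (odd⇒%2≡1 ox) ⟩
  double (1 + q * 2) % 4      ≡⟨ cong (_% 4) (double-1+2q q) ⟩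
  (2 + q * 4) % 4             ≡⟨ [m+kn]%n≡m%n 2 q 4 ⟩
  2                           ∎
  where
  open ≡-Reasoning
  q = x / 2

≡2mod4⇒double-odd : y % 4 ≡ 2 → ∃[ x ] Odd x × y ≡ double x
-- The witness is half of `2 + q * 4`, where `q` is `y / 4`.
≡2mod4⇒double-odd {y} y≡2 = 1 + q * 2 , odd , (begin
  y                   ≡⟨ m≡m%n+[m/n]*n y 4 ⟩
  y % 4 + q * 4       ≡⟨ cong (_+ q * 4) y≡2 ⟩
  2 + q * 4           ≡⟨ double-1+2q q ⟨
  double (1 + q * 2)  ∎)
  where
  open ≡-Reasoning
  q = y / 4
  odd : Odd (1 + q * 2)
  odd 2∣ with () ← ∣1⇒≡1 (∣m+n∣m⇒∣n (subst (2 ∣_) (+-comm 1 (q * 2)) 2∣) (divides-refl q))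

undouble : AllParts≡2mod4 ν → ∃[ κ ] All Odd κ × ν ≡ map double κ
undouble []                  = [] , [] , refl
undouble {y ∷ ν} (y≡2 ∷ ν≡2)
  with _ , ox , refl ← ≡2mod4⇒double-odd {y} y≡2 | _ , oκ , refl ← undouble {ν} ν≡2 =
  _ , ox ∷ oκ , refl

double-cancel-≤ : double x ≤ double y → x ≤ y
double-cancel-≤ {x} {y} le = subst₂ _≤_ (sym (n≡⌊n+n/2⌋ x)) (sym (n≡⌊n+n/2⌋ y)) (⌊n/2⌋-mono le)

double-cancel-pos : 0 < double x → 0 < x
double-cancel-pos {suc x} _ = s≤s z≤n

-- The pairs of partitions counted by the sum

partitions≡2mod4 : ℤ → List (List ℕ)
partitions≡2mod4 (+ n)    = filter allParts≡2mod4? (partitions n)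
partitions≡2mod4 -[1+ _ ] = []

length-partitions≡2mod4 : ∀ z → length (partitions≡2mod4 z) ≡ P₂′ z
length-partitions≡2mod4 (+ _)    = refl
length-partitions≡2mod4 -[1+ _ ] = refl

partitions≡2mod4-unique : ∀ z → Unique (partitions≡2mod4 z)
partitions≡2mod4-unique (+ n)    = Unique.filter⁺ allParts≡2mod4? (partitions-unique n)
partitions≡2mod4-unique -[1+ _ ] = []

∈-partitions≡2mod4⁻ : ∀ z → ν ∈ partitions≡2mod4 z →
                      + sum ν ≡ z × IsPartition (sum ν) ν × AllParts≡2mod4 ν
∈-partitions≡2mod4⁻ (+ n) ν∈ with ν∈′ , ν≡2 ← ∈-filter⁻ allParts≡2mod4? {xs = partitions n} ν∈
  with pos , ν↘ , refl ← ∈-partitions⁻ {n} ν∈′ = refl , (pos , ν↘ , refl) , ν≡2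

podPartitions : ℕ → List (List ℕ)
podPartitions j = filter oddPartsDistinct? (partitions j)

pairsOfSize : ℕ → ℕ → List (List ℕ × List ℕ)
pairsOfSize n j = cartesianProduct (podPartitions j) (partitions≡2mod4 (+ n - + j))

pairs : ℕ → ℕ → List (List ℕ × List ℕ)
pairs n m = concat (map (pairsOfSize n) (upTo m))

length-pairs : ∀ n m → length (pairs n m) ≡ sum (map (λ j → pod j * P₂′ (+ n - + j)) (upTo m))
length-pairs n m = trans (length-concat-map (pairsOfSize n) (upTo m))
  (cong sum (map-cong (λ j → trans (length-cartesianProduct (podPartitions j) _)
    (cong (pod j *_) (length-partitions≡2mod4 (+ n - + j)))) (upTo m)))

∈-pairsOfSize⁻ : ∀ n j → (μ , ν) ∈ pairsOfSize n j →
                 (IsPartition j μ × OddPartsDistinct μ) ×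
                 (+ sum ν ≡ + n - + j × IsPartition (sum ν) ν × AllParts≡2mod4 ν)
∈-pairsOfSize⁻ n j p∈ with μ∈ , ν∈ ← ∈-cartesianProduct⁻ (podPartitions j) _ p∈
  with μ∈′ , dμ ← ∈-filter⁻ oddPartsDistinct? {xs = partitions j} μ∈ =
  (∈-partitions⁻ {j} μ∈′ , dμ) , ∈-partitions≡2mod4⁻ (+ n - + j) ν∈

pairs-unique : ∀ n m → Unique (pairs n m)
pairs-unique n m = Unique.concat⁺
  (All.map⁺ (All.universal (λ j → Unique.cartesianProduct⁺
    (Unique.filter⁺ oddPartsDistinct? (partitions-unique j))
    (partitions≡2mod4-unique (+ n - + j))) (upTo m)))
  (AllPairs.map⁺ (AllPairs.map disjoint (Unique.upTo⁺ m)))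
  where
  -- The block index is recovered from a pair as the sum of its first component.
  disjoint : ∀ {i j} → i ≢ j → Disjoint (pairsOfSize n i) (pairsOfSize n j)
  disjoint {i} {j} i≢j (∈i , ∈j)
    with ((_ , _ , Σμ≡i) , _) , _ ← ∈-pairsOfSize⁻ n i ∈i
       | ((_ , _ , Σμ≡j) , _) , _ ← ∈-pairsOfSize⁻ n j ∈j = i≢j (trans (sym Σμ≡i) Σμ≡j)

+[m+n]-+m≡+n : ∀ m n → + (m + n) - + m ≡ + n
+[m+n]-+m≡+n m n =
  trans (cong (λ k → + k - + m) (+-comm m n)) (ℤ-Group.//-rightDividesʳ (+ m) (+ n))

+m≡+n-+o⇒m+o≡n : ∀ {m n o} → + m ≡ + n - + o → m + o ≡ n
+m≡+n-+o⇒m+o≡n {n = n} {o} eq =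
  ℤ.+-injective (trans (cong (ℤ._+ + o) eq) (ℤ-Group.//-rightDividesˡ (+ o) (+ n)))

-- The bijection and the count

toPair : List ℕ → List ℕ × List ℕ
toPair xs = proj₁ (split xs) , map double (proj₂ (split xs))

-- Doubling each entry of `κ` has the same effect on the sum as listing `κ` twice, so the claim
-- reduces to `split-↭`.
sum-split : ∀ xs → sum (proj₁ (split xs)) + sum (map double (proj₂ (split xs))) ≡ sum xs
sum-split xs with μ , κ ← split xs | ↭ ← split-↭ xs = begin
  sum μ + sum (map double κ)  ≡⟨ cong (sum μ ℕ.+_) (sum-map-double κ) ⟩
  sum μ + (sum κ + sum κ)     ≡⟨ cong (sum μ ℕ.+_) (sum-++ κ κ) ⟨
  sum μ + sum (κ ++ κ)        ≡⟨ sum-++ μ (κ ++ κ) ⟨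
  sum (unpair (μ , κ))        ≡⟨ sum-↭ ↭ ⟩
  sum xs                      ∎
  where open ≡-Reasoning

toPair-injective : AllPairs _≥_ xs → AllPairs _≥_ ys → toPair xs ≡ toPair ys → xs ≡ ys
toPair-injective xs↘ ys↘ eq with μ≡ , ν≡ ← ,-injective eq =
  split-injective xs↘ ys↘ (cong₂ _,_ μ≡ (map-injective double-injective ν≡))

toPair∈pairs : ∀ {n m} → n < m → IsPartition n xs → toPair xs ∈ pairs n m
toPair∈pairs {xs} {m = m} n<m (pos , xs↘ , refl)
  with μ↘ , κ↘ , oκ ← split-splitForm (Linked⇒AllPairs-≥ xs↘)
     | posμ , posκ ← split-All xs pos = ∈-concat⁺′
  (∈-cartesianProduct⁺
    (∈-filter⁺ oddPartsDistinct?
      (∈-partitions⁺ (posμ , AllPairs⇒Linked (AllPairs.map proj₁ μ↘) , refl)) (≥ᵒ⇒distinct μ↘))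
    (subst (λ z → map double (proj₂ (split xs)) ∈ partitions≡2mod4 z) (sym size)
      (∈-filter⁺ allParts≡2mod4?
        (∈-partitions⁺
          ( All.map⁺ (All.map (λ 0<x → ≤-trans 0<x (m≤m+n _ _)) posκ)
          , AllPairs⇒Linked (AllPairs.map⁺ (AllPairs.map (λ x≥y → +-mono-≤ x≥y x≥y) κ↘))
          , refl))
        (All.map⁺ (All.map double-odd oκ)))))
  -- The block containing the pair has index `sum (proj₁ (split xs))`, which is at most `sum xs` and
  -- hence below `m`.
  (∈-map⁺ (pairsOfSize (sum xs))
    (∈-upTo⁺ (≤-<-trans (subst (sum (proj₁ (split xs)) ≤_) (sum-split xs) (m≤m+n _ _)) n<m)))
  where
  size : + sum xs - + sum (proj₁ (split xs)) ≡ + sum (map double (proj₂ (split xs)))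
  size = trans (cong (λ s → + s - + sum (proj₁ (split xs))) (sym (sum-split xs)))
    (+[m+n]-+m≡+n (sum (proj₁ (split xs))) _)

∈pairs⇒toPair : ∀ {n m} → (μ , ν) ∈ pairs n m → ∃[ xs ] IsPartition n xs × toPair xs ≡ (μ , ν)
∈pairs⇒toPair {μ} {n = n} {m} p∈
  with _ , p∈′ , js∈ ← ∈-concat⁻′ (map (pairsOfSize n) (upTo m)) p∈
  with j , _ , refl ← ∈-map⁻ (pairsOfSize n) js∈
  with ((posμ , μ↘ , refl) , dμ) , Σν , (posν , ν↘ , _) , ν≡2 ← ∈-pairsOfSize⁻ n j p∈′
  with κ , oκ , refl ← undouble ν≡2
  -- Halving the entries of `ν` keeps their order, so `μ` and `κ` meet `SplitForm`.
  with xs , xs↘ , eq ← split-surjective μ κ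
         ( ≥∧distinct⇒≥ᵒ (Linked⇒AllPairs-≥ μ↘) dμ
         , AllPairs.map double-cancel-≤ (AllPairs.map⁻ (Linked⇒AllPairs-≥ ν↘)) , oκ) =
  xs
  , ( fibre-All posμ (All.map double-cancel-pos (All.map⁻ posν)) eq
    , AllPairs⇒Linked xs↘
    , trans (sym (sum-split xs))
        (trans (cong (λ (μ , κ) → sum μ + sum (map double κ)) eq)
          (trans (+-comm (sum μ) _) (+m≡+n-+o⇒m+o≡n Σν))))
  , cong (λ (μ , κ) → μ , map double κ) eq

theorem4p10 : ∀ (n : ℕ) → (λ j → pod j * P₂′ (+ n - + j)) HasSum p n
-- Once `m` is at least `suc n`, `upTo m` contains every `j ≤ n`; for larger `j` the argument of
-- `P₂′` is negative and the term is zero.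
theorem4p10 n = suc n , λ m n<m → begin
  sum (map (λ j → pod j * P₂′ (+ n - + j)) (upTo m))  ≡⟨ length-pairs n m ⟨
  length (pairs n m)                                  ≡⟨ ↭-length (image↭pairs m n<m) ⟨
  length (map toPair (partitions n))                  ≡⟨ length-map toPair (partitions n) ⟩
  p n                                                 ∎
  where
  open ≡-Reasoning
  sorted : ∀ {xs} → xs ∈ partitions n → AllPairs _≥_ xs
  sorted xs∈ = Linked⇒AllPairs-≥ (proj₁ (proj₂ (∈-partitions⁻ {n} xs∈)))
  image-unique : Unique (map toPair (partitions n))
  image-unique = map⁺-injectiveOn
    (λ xs∈ ys∈ → toPair-injective (sorted xs∈) (sorted ys∈)) (partitions-unique n)
  image⊆pairs : ∀ m → n < m → ∀ {z} → z ∈ map toPair (partitions n) → z ∈ pairs n m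
  image⊆pairs m n<m z∈ with _ , xs∈ , refl ← ∈-map⁻ toPair z∈ =
    toPair∈pairs n<m (∈-partitions⁻ {n} xs∈)
  pairs⊆image : ∀ m {z} → z ∈ pairs n m → z ∈ map toPair (partitions n)
  pairs⊆image m z∈ with _ , isPartition , refl ← ∈pairs⇒toPair {n = n} {m} z∈ =
    ∈-map⁺ toPair (∈-partitions⁺ isPartition)
  image↭pairs : ∀ m → n < m → map toPair (partitions n) ↭ pairs n m
  -- Two lists without repetitions and with the same members are permutations of each other.
  image↭pairs m n<m = ∼bag⇒↭ (unique∧set⇒bag image-unique (pairs-unique n m)
    (mk⇔ (image⊆pairs m n<m) (pairs⊆image m)))
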